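{- Let $\overrightarrow{W}$ be a Morse sequence on a simplicial complex $K$. Then for every $p$: (1) $H_p(\overline O)$ and $H_p(\widehat W)$ are isomorphic vector spaces; (2) $H^p(\underline O)$ and $H^p(\widehat W)$ are isomorphic vector spaces.
   Context: A simplicial complex $K$ is a finite collection of non-empty finite sets closed under taking non-empty subsets; $\dim\sigma=|\sigma|-1$, $K^{(p)}$ the set of $p$-simplices. A pair $(\sigma,\tau)$ with $\sigma\subsetneq\tau$ is a free pair for $K$ if $\tau$ is the only simplex other than $\sigma$ containing $\sigma$; $K$ is then an elementary expansion of $K\setminus\{\sigma,\tau\}$. If $\nu$ is a facet (maximal simplex) of $K$, $K$ is an elementary filling of $K\setminus\{\nu\}$. A Morse sequence on $K$ is a sequence $\langle\emptyset=K_0,\dots,K_k=K\rangle$ with each $K_i$ an elementary expansion or filling of $K_{i-1}$; simplices added by fillings are critical; for an expansion $K_i=K_{i-1}\cup\{\sigma,\tau\}$, $\sigma\subset\tau$, $\sigma$ is lower regular and $\tau$ upper regular. $\widehat W$ is the set of critical simplices. $K[p]$ is the $\mathbb{Z}_2$-vector space of subsets of $K^{(p)}$ (sum = symmetric difference, $0=\emptyset$), $\widehat W[p]=\{c\in K[p]:c\subseteq\widehat W\}$. For $\sigma\in K^{(p)}$, $\partial(\sigma)=\{\tau\in K^{(p-1)}:\tau\subset\sigma\}$, $\delta(\sigma)=\{\tau\in K^{(p+1)}:\sigma\subset\tau\}$, with linear extensions $\partial_p,\delta_p$. The reference map $\curlywedge$ is the unique map assigning to each $p$-simplex an element of $\widehat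 W[p]$, extended linearly, with $\curlywedge(\nu)=\{\nu\}$ for critical $\nu$ and $\curlywedge(\tau)=0=\curlywedge(\partial(\tau))$ for upper regular $\tau$; the coreference map $\curlyvee$ is the unique such map with $\curlyvee(\nu)=\{\nu\}$ for critical $\nu$ and $\curlyvee(\sigma)=0=\curlyvee(\delta(\sigma))$ for lower regular $\sigma$. Critical complex: $(\widehat W[p],\widehat\partial_p)$ with $\widehat\partial_p(c)=\curlywedge(\partial_p(c))$; cocritical complex $(\widehat W[p],\widehat\delta_p)$ with $\widehat\delta_p(c)=\curlyvee(\delta_p(c))$; $H_p(\widehat W)$ and $H^p(\widehat W)$ are their (co)homology spaces. Extension maps: $\widetilde\curlywedge_p,\widetilde\curlyvee_p:\widehat W[p]\to K[p]$ linear with $\widetilde\curlywedge(\kappa)=\{\nu\in K:\kappa\in\curlyvee(\nu)\}$, $\widetilde\curlyvee(\kappa)=\{\nu\in K:\kappa\in\curlywedge(\nu)\}$ for critical $p$-simplices $\kappa$. $\overline O[p]=\operatorname{im}\widetilde\curlywedge_p$ and $\underline O[p]=\operatorname{im}\widetilde\curlyvee_p$. The extension complex is the chain complex $(\overline O[p],\partial_p)$ and the coextension complex the cochain complex $(\underline O[p],\delta_p)$ (here $\partial_p$ maps $\overline O[p]$ into $\overline O[p-1]$ and $\delta_p$ maps $\underline O[p]$ into $\underline O[p+1]$); $H_p(\overline O)$ and $H^p(\underline O)$ denote their homology and cohomology spaces. -}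

module Defs where

open import Algebra.Bundles using (CommutativeRing; AbelianGroup)
import Algebra.Construct.Pointwise as Pointwise
open import Algebra.Module.Bundles using (Module)
open import Algebra.Module.Morphism.Structures using (module ModuleMorphisms)
import Algebra.Module.Morphism.Construct.Composition as Composition
open import Algebra.Module.Structures.Biased using (IsModuleFromLeft)
open import Algebra.Structures using (IsAbelianGroup)
import Algebra.Properties.AbelianGroup as AbelianGroupProperties
import Algebra.Properties.CommutativeSemigroup as CommutativeSemigroupProperties
open import Data.Bool.Base using (Bool; true; false; _∧_; _∨_; _xor_)
import Data.Bool.Properties as Bool
open import Data.Fin.Subset using (Subset; Nonempty; _⊆_; _⊂_; ∣_∣; inside; outside)
open import Data.Fin.Subset.Properties using (_⊂?_)
open import Data.Integer.Base using (ℤ; +_) renaming (suc to sucℤ; pred to predℤ)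
import Data.Integer.Properties as ℤ
open import Data.Nat.Base using (ℕ; zero; suc)
open import Data.Product.Base using (Σ; ∃; _×_; _,_; proj₁; proj₂)
open import Data.Sum.Base using (_⊎_; inj₁; inj₂; [_,_]′)
open import Data.Vec.Base using ([]; _∷_)
import Data.Vec.Properties as Vec
open import Function.Base using (_∘_; flip)
open import Function.Bundles using (_⇔_)
open import Level using (Level; 0ℓ; _⊔_) renaming (suc to lsuc)
open import Relation.Binary.Definitions using (DecidableEquality)
open import Relation.Binary.PropositionalEquality using (_≡_; _≢_; _≗_; refl; sym; trans; cong; cong₂)
open import Relation.Nullary.Decidable using (does)

private
  variable
    r ℓr m ℓm m′ ℓm′ s : Level

------------------------------------------------------------------------
-- Isomorphism, subspaces and homology of modules

infix 4 _≅_

_≅_ : {R : CommutativeRing r ℓr} →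
      Module R m ℓm → Module R m′ ℓm′ → Set (r ⊔ m ⊔ ℓm ⊔ m′ ⊔ ℓm′)
M ≅ N = ∃ (ModuleMorphisms.IsModuleIsomorphism (Module.rawModule M) (Module.rawModule N))

module _ {R : CommutativeRing r ℓr} (M : Module R m ℓm) where

  open Module M

  record Submodule (s : Level) : Set (r ⊔ m ⊔ ℓm ⊔ lsuc s) where
    field
      Member : Carrierᴹ → Set s
      resp   : ∀ {x y} → x ≈ᴹ y → Member x → Member y
      0∈     : Member 0ᴹ
      +∈     : ∀ {x y} → Member x → Member y → Member (x +ᴹ y)
      -∈     : ∀ {x} → Member x → Member (-ᴹ x)
      *∈     : ∀ k {x} → Member x → Member (k *ₗ x)

  record Endomorphism : Set (r ⊔ m ⊔ ℓm) where
    open ModuleMorphisms rawModule rawModule using (IsModuleHomomorphism)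
    field
      ⟦_⟧                  : Carrierᴹ → Carrierᴹ
      isModuleHomomorphism : IsModuleHomomorphism ⟦_⟧

module _ {R : CommutativeRing r ℓr} {M : Module R m ℓm} where

  open Module M
  open Submodule
  open Endomorphism using (⟦_⟧)

  private
    module AG = AbelianGroupProperties +ᴹ-abelianGroup
    module CS = CommutativeSemigroupProperties
      (AbelianGroup.commutativeSemigroup +ᴹ-abelianGroup)
    open import Relation.Binary.Reasoning.Setoid ≈ᴹ-setoid

  infixr 9 _∘ᴱ_

  _∘ᴱ_ : Endomorphism M → Endomorphism M → Endomorphism M
  g ∘ᴱ f = record
    { ⟦_⟧ = ⟦ g ⟧ ∘ ⟦ f ⟧
    ; isModuleHomomorphism = Composition.isModuleHomomorphism {M₁ = rawModule} {M₂ = rawModule} {M₃ = rawModule}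
        ≈ᴹ-trans (Endomorphism.isModuleHomomorphism f) (Endomorphism.isModuleHomomorphism g)
    }

  image : Endomorphism M → Submodule M s → Submodule M (m ⊔ ℓm ⊔ s)
  image f S = record
    { Member = λ x → ∃ λ c → Member S c × x ≈ᴹ ⟦ f ⟧ c
    ; resp   = λ { x≈y (c , c∈ , e) → c , c∈ , ≈ᴹ-trans (≈ᴹ-sym x≈y) e }
    ; 0∈     = 0ᴹ , 0∈ S , ≈ᴹ-sym 0ᴹ-homo
    ; +∈     = λ { (c , c∈ , e) (c′ , c′∈ , e′) →
                 c +ᴹ c′ , +∈ S c∈ c′∈ , ≈ᴹ-trans (+ᴹ-cong e e′) (≈ᴹ-sym (+ᴹ-homo c c′)) }
    ; -∈     = λ { (c , c∈ , e) →
                 -ᴹ c , -∈ S c∈ , ≈ᴹ-trans (-ᴹ‿cong e) (≈ᴹ-sym (-ᴹ-homo c)) }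
    ; *∈     = λ { k (c , c∈ , e) →
                 k *ₗ c , *∈ S k c∈ , ≈ᴹ-trans (*ₗ-congˡ e) (≈ᴹ-sym (*ₗ-homo k c)) }
    }
    where open ModuleMorphisms.IsModuleHomomorphism (Endomorphism.isModuleHomomorphism f)

  -- The homology at V of  U --d--> V --d--> _ : the elements of V killed
  -- by d, two of them being identified when they differ by an element of d(U).
  homology : Submodule M s → Submodule M s → Endomorphism M →
             Module R (m ⊔ ℓm ⊔ s) (m ⊔ ℓm ⊔ s)
  homology {s = s} U V d = record
    { Carrierᴹ = Cycle
    ; _≈ᴹ_     = _∼_
    ; _+ᴹ_     = _⊹_
    ; _*ₗ_     = _·_
    ; _*ᵣ_     = flip _·_
    ; 0ᴹ       = 𝟘
    ; -ᴹ_      = ⊝_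
    ; isModule = IsModuleFromLeft.isModule {commutativeRing = R} (record
      { isLeftModule = record
        { isLeftSemimodule = record
          { +ᴹ-isCommutativeMonoid = record
            { isMonoid = record
              { isSemigroup = record
                { isMagma = record
                  { isEquivalence = record
                    { refl  = λ {x} → reflexive {x} {x} ≈ᴹ-refl
                    ; sym   = λ {x} {y} → symm {x} {y}
                    ; trans = λ {x} {y} {z} → transit {x} {y} {z}
                    }
                  ; ∙-cong = λ {x} {y} {u} {v} → ⊹-cong {x} {y} {u} {v}
                  }
                ; assoc = λ x y z → reflexive {(x ⊹ y) ⊹ z} {x ⊹ (y ⊹ z)} (+ᴹ-assoc _ _ _)
                }
              ; identity = (λ x → reflexive {𝟘 ⊹ x} {x} (+ᴹ-identityˡ _))
                         , (λ x → reflexive {x ⊹ 𝟘} {x} (+ᴹ-identityʳ _))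
              }
            ; comm = λ x y → reflexive {x ⊹ y} {y ⊹ x} (+ᴹ-comm _ _)
            }
          ; isPreleftSemimodule = record
            { *ₗ-cong = λ {k} {l} {x} {y} → ·-cong {k} {l} {x} {y}
            ; *ₗ-zeroˡ = λ x → reflexive {_ · x} {𝟘} (*ₗ-zeroˡ _)
            ; *ₗ-distribʳ = λ x k l → reflexive {_ · x} {(k · x) ⊹ (l · x)} (*ₗ-distribʳ _ _ _)
            ; *ₗ-identityˡ = λ x → reflexive {_ · x} {x} (*ₗ-identityˡ _)
            ; *ₗ-assoc = λ k l x → reflexive {_ · x} {k · (l · x)} (*ₗ-assoc _ _ _)
            ; *ₗ-zeroʳ = λ k → reflexive {k · 𝟘} {𝟘} (*ₗ-zeroʳ _)
            ; *ₗ-distribˡ = λ k x y → reflexive {k · (x ⊹ y)} {(k · x) ⊹ (k · y)} (*ₗ-distribˡ _ _ _)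
            }
          }
        ; -ᴹ‿cong = λ {x} {y} → ⊝-cong {x} {y}
        ; -ᴹ‿inverse = (λ x → reflexive {(⊝ x) ⊹ x} {𝟘} (-ᴹ‿inverseˡ _))
                     , (λ x → reflexive {x ⊹ (⊝ x)} {𝟘} (-ᴹ‿inverseʳ _))
        }
      })
    }
    where
    open ModuleMorphisms.IsModuleHomomorphism (Endomorphism.isModuleHomomorphism d)
    open CommutativeRing R using (Carrier; _≈_)

    Cycle : Set (m ⊔ ℓm ⊔ s)
    Cycle = Σ Carrierᴹ λ x → Member V x × ⟦ d ⟧ x ≈ᴹ 0ᴹ

    _∼_ : Cycle → Cycle → Set (m ⊔ ℓm ⊔ s)
    (x , _) ∼ (y , _) = ∃ λ b → Member U b × ⟦ d ⟧ b ≈ᴹ x +ᴹ (-ᴹ y)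

    _⊹_ : Cycle → Cycle → Cycle
    (x , x∈ , dx) ⊹ (y , y∈ , dy) = x +ᴹ y , +∈ V x∈ y∈ ,
      ≈ᴹ-trans (+ᴹ-homo x y) (≈ᴹ-trans (+ᴹ-cong dx dy) (+ᴹ-identityˡ 0ᴹ))

    _·_ : Carrier → Cycle → Cycle
    k · (x , x∈ , dx) = k *ₗ x , *∈ V k x∈ ,
      ≈ᴹ-trans (*ₗ-homo k x) (≈ᴹ-trans (*ₗ-congˡ dx) (*ₗ-zeroʳ k))

    𝟘 : Cycle
    𝟘 = 0ᴹ , 0∈ V , 0ᴹ-homo

    ⊝_ : Cycle → Cycle
    ⊝ (x , x∈ , dx) = -ᴹ x , -∈ V x∈ ,
      ≈ᴹ-trans (-ᴹ-homo x) (≈ᴹ-trans (-ᴹ‿cong dx) AG.ε⁻¹≈ε)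

    *ₗ-neg : ∀ k x → k *ₗ (-ᴹ x) ≈ᴹ -ᴹ (k *ₗ x)
    *ₗ-neg k x = AG.inverseˡ-unique (k *ₗ (-ᴹ x)) (k *ₗ x) (begin
      k *ₗ (-ᴹ x) +ᴹ k *ₗ x  ≈⟨ *ₗ-distribˡ k (-ᴹ x) x ⟨
      k *ₗ ((-ᴹ x) +ᴹ x)     ≈⟨ *ₗ-congˡ (-ᴹ‿inverseˡ x) ⟩
      k *ₗ 0ᴹ                ≈⟨ *ₗ-zeroʳ k ⟩
      0ᴹ                     ∎)

    reflexive : {x y : Cycle} → proj₁ x ≈ᴹ proj₁ y → x ∼ y
    reflexive {x , _} {y , _} x≈y = 0ᴹ , 0∈ U , (begin
      ⟦ d ⟧ 0ᴹ     ≈⟨ 0ᴹ-homo ⟩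
      0ᴹ           ≈⟨ -ᴹ‿inverseʳ y ⟨
      y +ᴹ (-ᴹ y)  ≈⟨ +ᴹ-congʳ x≈y ⟨
      x +ᴹ (-ᴹ y)  ∎)

    ⊝-cong : {x y : Cycle} → x ∼ y → (⊝ x) ∼ (⊝ y)
    ⊝-cong {x , _} {y , _} (b , b∈ , e) = -ᴹ b , -∈ U b∈ , (begin
      ⟦ d ⟧ (-ᴹ b)             ≈⟨ -ᴹ-homo b ⟩
      -ᴹ (⟦ d ⟧ b)             ≈⟨ -ᴹ‿cong e ⟩
      -ᴹ (x +ᴹ (-ᴹ y))         ≈⟨ AG.⁻¹-∙-comm x (-ᴹ y) ⟨
      (-ᴹ x) +ᴹ (-ᴹ (-ᴹ y))    ∎)

    symm : {x y : Cycle} → x ∼ y → y ∼ x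
    symm {x , p} {y , q} x∼y with b , b∈ , e ← ⊝-cong {x , p} {y , q} x∼y = b , b∈ , (begin
      ⟦ d ⟧ b                  ≈⟨ e ⟩
      (-ᴹ x) +ᴹ (-ᴹ (-ᴹ y))    ≈⟨ +ᴹ-congˡ (AG.⁻¹-involutive y) ⟩
      (-ᴹ x) +ᴹ y              ≈⟨ +ᴹ-comm (-ᴹ x) y ⟩
      y +ᴹ (-ᴹ x)              ∎)

    transit : {x y z : Cycle} → x ∼ y → y ∼ z → x ∼ z
    transit {x , _} {y , _} {z , _} (b , b∈ , e) (c , c∈ , f) = b +ᴹ c , +∈ U b∈ c∈ , (begin
      ⟦ d ⟧ (b +ᴹ c)                   ≈⟨ +ᴹ-homo b c ⟩
      ⟦ d ⟧ b +ᴹ ⟦ d ⟧ c               ≈⟨ +ᴹ-cong e f ⟩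
      (x +ᴹ (-ᴹ y)) +ᴹ (y +ᴹ (-ᴹ z))   ≈⟨ +ᴹ-assoc x (-ᴹ y) (y +ᴹ (-ᴹ z)) ⟩
      x +ᴹ ((-ᴹ y) +ᴹ (y +ᴹ (-ᴹ z)))   ≈⟨ +ᴹ-congˡ (+ᴹ-assoc (-ᴹ y) y (-ᴹ z)) ⟨
      x +ᴹ (((-ᴹ y) +ᴹ y) +ᴹ (-ᴹ z))   ≈⟨ +ᴹ-congˡ (+ᴹ-congʳ (-ᴹ‿inverseˡ y)) ⟩
      x +ᴹ (0ᴹ +ᴹ (-ᴹ z))              ≈⟨ +ᴹ-congˡ (+ᴹ-identityˡ (-ᴹ z)) ⟩
      x +ᴹ (-ᴹ z)                      ∎)

    ⊹-cong : {x y u v : Cycle} → x ∼ y → u ∼ v → (x ⊹ u) ∼ (y ⊹ v)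
    ⊹-cong {x , _} {y , _} {u , _} {v , _} (b , b∈ , e) (c , c∈ , f) = b +ᴹ c , +∈ U b∈ c∈ , (begin
      ⟦ d ⟧ (b +ᴹ c)                   ≈⟨ +ᴹ-homo b c ⟩
      ⟦ d ⟧ b +ᴹ ⟦ d ⟧ c               ≈⟨ +ᴹ-cong e f ⟩
      (x +ᴹ (-ᴹ y)) +ᴹ (u +ᴹ (-ᴹ v))   ≈⟨ CS.interchange x (-ᴹ y) u (-ᴹ v) ⟩
      (x +ᴹ u) +ᴹ ((-ᴹ y) +ᴹ (-ᴹ v))   ≈⟨ +ᴹ-congˡ (AG.⁻¹-∙-comm y v) ⟩
      (x +ᴹ u) +ᴹ (-ᴹ (y +ᴹ v))        ∎)

    ·-cong : {k l : Carrier} {x y : Cycle} → k ≈ l → x ∼ y → (k · x) ∼ (l · y)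
    ·-cong {k} {l} {x , _} {y , _} k≈l (b , b∈ , e) = k *ₗ b , *∈ U k b∈ , (begin
      ⟦ d ⟧ (k *ₗ b)                   ≈⟨ *ₗ-homo k b ⟩
      k *ₗ ⟦ d ⟧ b                     ≈⟨ *ₗ-congˡ e ⟩
      k *ₗ (x +ᴹ (-ᴹ y))               ≈⟨ *ₗ-distribˡ k x (-ᴹ y) ⟩
      k *ₗ x +ᴹ k *ₗ (-ᴹ y)            ≈⟨ +ᴹ-congˡ (*ₗ-neg k y) ⟩
      k *ₗ x +ᴹ (-ᴹ (k *ₗ y))          ≈⟨ +ᴹ-congˡ (-ᴹ‿cong (*ₗ-congʳ k≈l)) ⟩
      k *ₗ x +ᴹ (-ᴹ (l *ₗ y))          ∎)

------------------------------------------------------------------------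
-- Simplicial complexes on the vertex set Fin n

private
  variable
    n : ℕ

-- A set of subsets of Fin n.  This is used both for complexes and for
-- chains; as chains, families are added by symmetric difference and
-- compared pointwise.
Family : ℕ → Set
Family n = Subset n → Bool

infix 4 _∈_

_∈_ : Subset n → Family n → Set
σ ∈ F = F σ ≡ true

∅ : Family n
∅ _ = false

_≟_ : DecidableEquality (Subset n)
_≟_ = Vec.≡-dec Bool._≟_

⁅_⁆ : Subset n → Family n
⁅ σ ⁆ τ = does (τ ≟ σ)

_∪_ : Family n → Family n → Family n
(F ∪ G) σ = F σ ∨ G σ

dim : Subset n → ℤ
dim σ = predℤ (+ ∣ σ ∣)

record SimplicialComplex (n : ℕ) : Set where
  field
    simplices : Family n
    nonempty  : ∀ {σ} → σ ∈ simplices → Nonempty σ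
    closed    : ∀ {σ τ} → τ ∈ simplices → σ ⊆ τ → Nonempty σ → σ ∈ simplices

open SimplicialComplex public using (simplices)

record FreePair (K : SimplicialComplex n) (σ τ : Subset n) : Set where
  field
    σ∈K  : σ ∈ simplices K
    τ∈K  : τ ∈ simplices K
    σ⊂τ  : σ ⊂ τ
    only : ∀ {ρ} → ρ ∈ simplices K → σ ⊆ ρ → ρ ≢ σ → ρ ≡ τ

record Facet (K : SimplicialComplex n) (ν : Subset n) : Set where
  field
    ν∈K     : ν ∈ simplices K
    maximal : ∀ {ρ} → ρ ∈ simplices K → ν ⊆ ρ → ρ ≡ ν

record Expansion (L K : SimplicialComplex n) (σ τ : Subset n) : Set where
  field
    freePair   : FreePair K σ τ
    difference : ∀ ρ → ρ ∈ simplices L ⇔ (ρ ∈ simplices K × ρ ≢ σ × ρ ≢ τ)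

record Filling (L K : SimplicialComplex n) (ν : Subset n) : Set where
  field
    facet      : Facet K ν
    difference : ∀ ρ → ρ ∈ simplices L ⇔ (ρ ∈ simplices K × ρ ≢ ν)

data MorseSequence {n : ℕ} : SimplicialComplex n → Set where
  start  : ∀ {K} → simplices K ≗ ∅ → MorseSequence K
  expand : ∀ {L K} → MorseSequence L → ∀ σ τ → Expansion L K σ τ → MorseSequence K
  fill   : ∀ {L K} → MorseSequence L → ∀ ν → Filling L K ν → MorseSequence K

critical : {K : SimplicialComplex n} → MorseSequence K → Family n
critical (start _)        = ∅
critical (expand W σ τ _) = critical W
critical (fill W ν _)     = critical W ∪ ⁅ ν ⁆

lowerRegular : {K : SimplicialComplex n} → MorseSequence K → Family n
lowerRegular (start _)        = ∅
lowerRegular (expand W σ τ _) = lowerRegular W ∪ ⁅ σ ⁆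
lowerRegular (fill W ν _)     = lowerRegular W

upperRegular : {K : SimplicialComplex n} → MorseSequence K → Family n
upperRegular (start _)        = ∅
upperRegular (expand W σ τ _) = upperRegular W ∪ ⁅ τ ⁆
upperRegular (fill W ν _)     = upperRegular W

------------------------------------------------------------------------
-- Chains modulo 2

𝔽₂ : CommutativeRing 0ℓ 0ℓ
𝔽₂ = Bool.xor-∧-commutativeRing

chainModule : ℕ → Module 𝔽₂ 0ℓ 0ℓ
chainModule n = record
  { Carrierᴹ = Family n
  ; _≈ᴹ_     = _≗_
  ; _+ᴹ_     = λ c c′ σ → c σ xor c′ σ
  ; _*ₗ_     = λ k c σ → k ∧ c σ
  ; _*ᵣ_     = λ c k σ → k ∧ c σ
  ; 0ᴹ       = ∅
  ; -ᴹ_      = λ c → c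
  ; isModule = IsModuleFromLeft.isModule {commutativeRing = 𝔽₂} (record
    { isLeftModule = record
      { isLeftSemimodule = record
        { +ᴹ-isCommutativeMonoid = A.isCommutativeMonoid
        ; isPreleftSemimodule = record
          { *ₗ-cong      = λ k≡l c≗c′ σ → cong₂ _∧_ k≡l (c≗c′ σ)
          ; *ₗ-zeroˡ     = λ _ _ → refl
          ; *ₗ-distribʳ  = λ c k l σ → Bool.∧-distribʳ-xor (c σ) k l
          ; *ₗ-identityˡ = λ _ _ → refl
          ; *ₗ-assoc     = λ k l c σ → Bool.∧-assoc k l (c σ)
          ; *ₗ-zeroʳ     = λ k σ → Bool.∧-zeroʳ k
          ; *ₗ-distribˡ  = λ k c c′ σ → Bool.∧-distribˡ-xor k (c σ) (c′ σ)
          }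
        }
      ; -ᴹ‿cong    = A.⁻¹-cong
      ; -ᴹ‿inverse = A.inverse
      }
    })
  }
  where
  module A = IsAbelianGroup
    (Pointwise.isAbelianGroup (Subset n) (CommutativeRing.+-isAbelianGroup 𝔽₂))

supportedOn : (Subset n → Set) → Submodule (chainModule n) 0ℓ
supportedOn P = record
  { Member = λ c → ∀ {σ} → σ ∈ c → P σ
  ; resp   = λ c≗c′ c∈ {σ} σ∈ → c∈ (trans (c≗c′ σ) σ∈)
  ; 0∈     = λ ()
  ; +∈     = λ {c} {c′} c∈ c′∈ {σ} σ∈ → [ c∈ , c′∈ ]′ (split (c σ) (c′ σ) σ∈)
  ; -∈     = λ c∈ → c∈
  ; *∈     = λ { true c∈ → c∈ ; false c∈ () }
  }
  where
  split : ∀ a b → a xor b ≡ true → a ≡ true ⊎ b ≡ true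
  split true  b _ = inj₁ refl
  split false b e = inj₂ e

-- Sum modulo 2 over all subsets of Fin n.
⨁ : (Subset n → Bool) → Bool
⨁ {zero}  f = f []
⨁ {suc n} f = ⨁ (λ σ → f (outside ∷ σ)) xor ⨁ (λ σ → f (inside ∷ σ))

⨁-cong : {f g : Subset n → Bool} → f ≗ g → ⨁ f ≡ ⨁ g
⨁-cong {zero}  e = e []
⨁-cong {suc n} e = cong₂ _xor_ (⨁-cong (λ σ → e (outside ∷ σ))) (⨁-cong (λ σ → e (inside ∷ σ)))

⨁-xor : (f g : Subset n → Bool) → ⨁ (λ σ → f σ xor g σ) ≡ ⨁ f xor ⨁ g
⨁-xor {zero}  f g = refl
⨁-xor {suc n} f g = trans
  (cong₂ _xor_ (⨁-xor (λ σ → f (outside ∷ σ)) (λ σ → g (outside ∷ σ)))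
               (⨁-xor (λ σ → f (inside ∷ σ)) (λ σ → g (inside ∷ σ))))
  (interchange (⨁ (λ σ → f (outside ∷ σ))) _ _ _)
  where
  open CommutativeSemigroupProperties
    (AbelianGroup.commutativeSemigroup (CommutativeRing.+-abelianGroup 𝔽₂)) using (interchange)

⨁-∧ : ∀ k (f : Subset n → Bool) → ⨁ (λ σ → k ∧ f σ) ≡ k ∧ ⨁ f
⨁-∧ {zero}  k f = refl
⨁-∧ {suc n} k f = trans
  (cong₂ _xor_ (⨁-∧ k (λ σ → f (outside ∷ σ))) (⨁-∧ k (λ σ → f (inside ∷ σ))))
  (sym (Bool.∧-distribˡ-xor k (⨁ (λ σ → f (outside ∷ σ))) _))

linearExtension : (Subset n → Family n) → Endomorphism (chainModule n)
linearExtension {n} f = record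
  { ⟦_⟧ = ext
  ; isModuleHomomorphism = record { isBimoduleHomomorphism = record
    { +ᴹ-isGroupHomomorphism = record
      { isMonoidHomomorphism = record
        { isMagmaHomomorphism = record
          { isRelHomomorphism = record { cong = ext-cong }
          ; homo = λ c c′ τ → trans
              (⨁-cong (λ σ → Bool.∧-distribʳ-xor (f σ τ) (c σ) (c′ σ)))
              (⨁-xor (λ σ → c σ ∧ f σ τ) (λ σ → c′ σ ∧ f σ τ))
          }
        ; ε-homo = λ τ → ⨁-∧ {n} false (λ _ → false)
        }
      ; ⁻¹-homo = λ _ _ → refl
      }
    ; *ₗ-homo = scale
    ; *ᵣ-homo = scale
    } }
  }
  where
  ext : Family n → Family n
  ext c τ = ⨁ (λ σ → c σ ∧ f σ τ)

  ext-cong : ∀ {c c′} → c ≗ c′ → ext c ≗ ext c′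
  ext-cong e τ = ⨁-cong (λ σ → cong (_∧ f σ τ) (e σ))

  scale : ∀ k c → ext (λ σ → k ∧ c σ) ≗ (λ σ → k ∧ ext c σ)
  scale k c τ = trans
    (⨁-cong (λ σ → Bool.∧-assoc k (c σ) (f σ τ)))
    (⨁-∧ k (λ σ → c σ ∧ f σ τ))

open Submodule public using (Member)
open Endomorphism public using (⟦_⟧)

module _ (K : SimplicialComplex n) where

  boundary : Subset n → Family n
  boundary σ τ = simplices K τ ∧ does (τ ⊂? σ) ∧ does (dim τ ℤ.≟ predℤ (dim σ))

  coboundary : Subset n → Family n
  coboundary σ τ = simplices K τ ∧ does (σ ⊂? τ) ∧ does (dim τ ℤ.≟ sucℤ (dim σ))

  -- Each differential is a single operator on chains of all degrees, to be
  -- restricted to the subspace of p-chains under consideration.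
  ∂ δ : Endomorphism (chainModule n)
  ∂ = linearExtension boundary
  δ = linearExtension coboundary

-- The degree p ranges over ℤ, so that degrees p - 1 and p + 1 are always
-- available; there are no simplices, hence only the zero chain, in negative degree.
IsSimplex : SimplicialComplex n → ℤ → Subset n → Set
IsSimplex K p σ = σ ∈ simplices K × dim σ ≡ p

------------------------------------------------------------------------
-- Reference maps and the complexes of a Morse sequence

module _ {K : SimplicialComplex n} (W : MorseSequence K) where

  Ŵ[_] : ℤ → Submodule (chainModule n) 0ℓ
  Ŵ[ p ] = supportedOn (λ σ → IsSimplex K p σ × σ ∈ critical W)

  -- The values of the two maps outside of K are left free; nothing below
  -- depends on them.
  record ReferenceMap : Set where
    field
      map         : Subset n → Family n
      map-chain   : ∀ {p σ} → IsSimplex K p σ → Member Ŵ[ p ] (map σ)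
      on-critical : ∀ {ν} → ν ∈ critical W → map ν ≗ ⁅ ν ⁆
      on-upper    : ∀ {τ} → τ ∈ upperRegular W → map τ ≗ ∅
      on-boundary : ∀ {τ} → τ ∈ upperRegular W → ⟦ linearExtension map ⟧ (boundary K τ) ≗ ∅

  record CoreferenceMap : Set where
    field
      map           : Subset n → Family n
      map-chain     : ∀ {p σ} → IsSimplex K p σ → Member Ŵ[ p ] (map σ)
      on-critical   : ∀ {ν} → ν ∈ critical W → map ν ≗ ⁅ ν ⁆
      on-lower      : ∀ {σ} → σ ∈ lowerRegular W → map σ ≗ ∅
      on-coboundary : ∀ {σ} → σ ∈ lowerRegular W → ⟦ linearExtension map ⟧ (coboundary K σ) ≗ ∅

module _ {K : SimplicialComplex n} {W : MorseSequence K} where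

  ⋏ : ReferenceMap W → Endomorphism (chainModule n)
  ⋏ ref = linearExtension (ReferenceMap.map ref)

  ⋎ : CoreferenceMap W → Endomorphism (chainModule n)
  ⋎ coref = linearExtension (CoreferenceMap.map coref)

  -- The extension map is defined from the coreference map, and conversely.
  ⋏̃ : CoreferenceMap W → Endomorphism (chainModule n)
  ⋏̃ coref = linearExtension (λ κ ν → simplices K ν ∧ CoreferenceMap.map coref ν κ)

  ⋎̃ : ReferenceMap W → Endomorphism (chainModule n)
  ⋎̃ ref = linearExtension (λ κ ν → simplices K ν ∧ ReferenceMap.map ref ν κ)

  Ō[_] : CoreferenceMap W → ℤ → Submodule (chainModule n) 0ℓ
  Ō[ coref ] p = image (⋏̃ coref) (Ŵ[ W ] p)

  O̲[_] : ReferenceMap W → ℤ → Submodule (chainModule n) 0ℓ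
  O̲[ ref ] p = image (⋎̃ ref) (Ŵ[ W ] p)

  criticalHomology : ReferenceMap W → ℤ → Module 𝔽₂ 0ℓ 0ℓ
  criticalHomology ref p = homology (Ŵ[ W ] (sucℤ p)) (Ŵ[ W ] p) (⋏ ref ∘ᴱ ∂ K)

  cocriticalCohomology : CoreferenceMap W → ℤ → Module 𝔽₂ 0ℓ 0ℓ
  cocriticalCohomology coref p = homology (Ŵ[ W ] (predℤ p)) (Ŵ[ W ] p) (⋎ coref ∘ᴱ δ K)

  extensionHomology : CoreferenceMap W → ℤ → Module 𝔽₂ 0ℓ 0ℓ
  extensionHomology coref p = homology (Ō[ coref ] (sucℤ p)) (Ō[ coref ] p) (∂ K)

  coextensionCohomology : ReferenceMap W → ℤ → Module 𝔽₂ 0ℓ 0ℓ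
  coextensionCohomology ref p = homology (O̲[ ref ] (predℤ p)) (O̲[ ref ] p) (δ K)

{-# OPTIONS --safe #-}
-- Write r and e for the reference and extension maps and d for the boundary.
-- A chain in the image of e has no lower regular simplex, its critical part is
-- the chain it came from, and its boundary has no lower regular simplex either.
-- Conversely, a chain with these two vanishing properties is determined by its
-- critical part: a chain of upper regular simplices whose boundary avoids the
-- lower regular ones is zero, as its last simplex τ is the only one in it that
-- contains the partner of τ.  As d d = 0, the chain d (e c) has both properties,
-- whence d (e c) = e (r (d (e c))) = e (r (d c)), while r (e c) = c.  So e is an
-- isomorphism of complexes with inverse r.  The second half is the same argument
-- for the transposed differential, with lower and upper exchanged and "last"
-- replaced by "first".
module Submission where

open import Defs
open import Algebra.Bundles using (CommutativeRing)
open import Algebra.Module.Bundles using (Module)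
open import Algebra.Module.Morphism.Structures using (module ModuleMorphisms)
open import Data.Bool.Base using (Bool; true; false; _∧_; _∨_; _xor_; not)
import Data.Bool.Properties as Bool
open import Data.Fin.Base using (Fin; zero; suc)
open import Data.Fin.Subset using (Subset; _⊆_; _⊂_; ∣_∣; inside; outside) renaming (_∈_ to _∈ˢ_; _∉_ to _∉ˢ_)
open import Data.Fin.Subset.Properties using (_⊂?_; drop-∷-⊆; drop-∷-⊂; s⊂s; out⊂in; p⊆q⇒∣p∣≤∣q∣)
open import Data.Integer.Base using (ℤ; +_) renaming (suc to sucℤ; pred to predℤ)
import Data.Integer.Properties as ℤ
open import Data.Nat.Base using (ℕ; zero; suc)
import Data.Nat.Properties as ℕ
open import Data.Product.Base using (∃; _×_; _,_; proj₁; proj₂)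
open import Data.Sum.Base using (_⊎_; inj₁; inj₂; map; map₁; map₂; swap)
open import Data.Vec.Base using ([]; _∷_; _[_]≔_; here; there)
open import Data.Vec.Properties using ([]≔-updates)
open import Function.Base using (_∘_)
open import Function.Bundles using (_⇔_; mk⇔; Equivalence)
open import Function.Construct.Composition using (_⇔-∘_)
open import Level using (Level)
open import Relation.Binary.PropositionalEquality using (_≡_; _≢_; _≗_; refl; sym; trans; cong; cong₂; subst; module ≡-Reasoning)
open import Relation.Nullary.Decidable using (does; yes; no; Dec; dec-true; dec-false)
open import Relation.Nullary.Negation using (contradiction)

private
  variable
    a ℓ m ℓm s w : Level
    n : ℕ

-- Homology of the isomorphic image of a complex

module _ {R : CommutativeRing a ℓ} {M : Module R m ℓm} where

  open Module M
  open Submodule using (resp; 0∈)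
  private
    open import Relation.Binary.Reasoning.Setoid ≈ᴹ-setoid
    module Hom (f : Endomorphism M) = ModuleMorphisms.IsModuleHomomorphism (Endomorphism.isModuleHomomorphism f)

  -- The second hypothesis makes `e` commute with the differentials `r ∘ d` and `d`, and `r` inverts
  -- `e`, so both maps descend to homology. `C` is a common home for `U` and `V`, which lets one set
  -- of hypotheses serve both degrees.
  image-homology-≅ :
    (d r e : Endomorphism M) (C : Carrierᴹ → Set w) →
    (∀ {c} → C c → ⟦ r ⟧ (⟦ e ⟧ c) ≈ᴹ c) →
    (∀ {c} → C c → ⟦ d ⟧ (⟦ e ⟧ c) ≈ᴹ ⟦ e ⟧ (⟦ r ⟧ (⟦ d ⟧ c))) →
    (∀ {c} → C c → C (⟦ r ⟧ (⟦ d ⟧ c))) →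
    (U V : Submodule M s) → (∀ {c} → Member U c → C c) → (∀ {c} → Member V c → C c) →
    homology (image e U) (image e V) d ≅ homology U V (r ∘ᴱ d)
  image-homology-≅ d r e C r-e d-e r-d U V U⊆C V⊆C = f , record
    { isModuleMonomorphism = record
      { isModuleHomomorphism = record
        { isBimoduleHomomorphism = record
          { +ᴹ-isGroupHomomorphism = record
            { isMonoidHomomorphism = record
              { isMagmaHomomorphism = record
                { isRelHomomorphism = record { cong = λ {x} {y} → f-cong {x} {y} }
                ; homo = λ _ _ → reflexive (r.+ᴹ-homo _ _)
                }
              ; ε-homo = reflexive r.0ᴹ-homo
              }
            ; ⁻¹-homo = λ _ → reflexive (r.-ᴹ-homo _)
            }
          ; *ₗ-homo = λ _ _ → reflexive (r.*ₗ-homo _ _)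
          ; *ᵣ-homo = λ _ _ → reflexive (r.*ₗ-homo _ _)
          }
        }
      ; injective = λ {x} {y} → f-injective {x} {y}
      }
    -- Surjectivity between setoids is asked for every representative `z` of the class of `g y`,
    -- hence the detour through `f-cong`.
    ; surjective = λ y → g y , λ {z} z∼gy → H.≈ᴹ-trans {f z} {f (g y)} {y}
        (f-cong {z} {g y} z∼gy) (reflexive (r-e (V⊆C (proj₁ (proj₂ y)))))
    }
    where
    module d = Hom d
    module r = Hom r
    module e = Hom e
    module H̄ = Module (homology (image e U) (image e V) d)
    module H = Module (homology U V (r ∘ᴱ d))

    -- Applying `r` to `d (e c) = e (r (d c))` recovers `r (d c)`, because this element lies in `C`
    -- again.
    r-d-0 : ∀ {c} → C c → ⟦ d ⟧ (⟦ e ⟧ c) ≈ᴹ 0ᴹ → ⟦ r ⟧ (⟦ d ⟧ c) ≈ᴹ 0ᴹ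
    r-d-0 {c} c∈ dec≈0 = begin
      ⟦ r ⟧ (⟦ d ⟧ c)                  ≈⟨ r-e (r-d c∈) ⟨
      ⟦ r ⟧ (⟦ e ⟧ (⟦ r ⟧ (⟦ d ⟧ c)))  ≈⟨ r.⟦⟧-cong (d-e c∈) ⟨
      ⟦ r ⟧ (⟦ d ⟧ (⟦ e ⟧ c))          ≈⟨ r.⟦⟧-cong dec≈0 ⟩
      ⟦ r ⟧ 0ᴹ                         ≈⟨ r.0ᴹ-homo ⟩
      0ᴹ                               ∎

    r-inverse : ∀ {x c} → C c → x ≈ᴹ ⟦ e ⟧ c → ⟦ r ⟧ x ≈ᴹ c
    r-inverse c∈ x≈ec = ≈ᴹ-trans (r.⟦⟧-cong x≈ec) (r-e c∈)

    e-inverse : ∀ {x c} → C c → x ≈ᴹ ⟦ e ⟧ c → ⟦ e ⟧ (⟦ r ⟧ x) ≈ᴹ x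
    e-inverse c∈ x≈ec = ≈ᴹ-trans (e.⟦⟧-cong (r-inverse c∈ x≈ec)) (≈ᴹ-sym x≈ec)

    f : H̄.Carrierᴹ → H.Carrierᴹ
    f (x , (c , c∈ , x≈ec) , dx≈0) = ⟦ r ⟧ x , resp V (≈ᴹ-sym rx≈c) c∈ , (begin
      ⟦ r ⟧ (⟦ d ⟧ (⟦ r ⟧ x))  ≈⟨ r.⟦⟧-cong (d.⟦⟧-cong rx≈c) ⟩
      ⟦ r ⟧ (⟦ d ⟧ c)          ≈⟨ r-d-0 (V⊆C c∈) (≈ᴹ-trans (d.⟦⟧-cong (≈ᴹ-sym x≈ec)) dx≈0) ⟩
      0ᴹ                       ∎)
      where rx≈c = r-inverse (V⊆C c∈) x≈ec

    g : H.Carrierᴹ → H̄.Carrierᴹ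
    g (y , y∈ , rdy≈0) = ⟦ e ⟧ y , (y , y∈ , ≈ᴹ-refl) ,
      ≈ᴹ-trans (d-e (V⊆C y∈)) (≈ᴹ-trans (e.⟦⟧-cong rdy≈0) e.0ᴹ-homo)

    -- Phrased for underlying elements rather than cycles: equality in homology mentions only these,
    -- so each homomorphism law of `f` is inherited from `r`.
    reflexive : ∀ {x y} → x ≈ᴹ y → ∃ λ b → Member U b × ⟦ r ⟧ (⟦ d ⟧ b) ≈ᴹ x +ᴹ (-ᴹ y)
    reflexive {x} {y} x≈y = 0ᴹ , 0∈ U , (begin
      ⟦ r ⟧ (⟦ d ⟧ 0ᴹ)  ≈⟨ r.⟦⟧-cong d.0ᴹ-homo ⟩
      ⟦ r ⟧ 0ᴹ          ≈⟨ r.0ᴹ-homo ⟩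
      0ᴹ                ≈⟨ -ᴹ‿inverseʳ y ⟨
      y +ᴹ (-ᴹ y)       ≈⟨ +ᴹ-congʳ x≈y ⟨
      x +ᴹ (-ᴹ y)       ∎)

    f-cong : ∀ {x y} → x H̄.≈ᴹ y → f x H.≈ᴹ f y
    -- The bounding element is the preimage `c` of `b` under `e`: it is equal to `r b` and comes
    -- with a proof that it lies in `U`.
    f-cong {x , _} {y , _} (b , (c , c∈ , b≈ec) , db≈x-y) = c , c∈ , (begin
      ⟦ r ⟧ (⟦ d ⟧ c)                  ≈⟨ r-e (r-d (U⊆C c∈)) ⟨
      ⟦ r ⟧ (⟦ e ⟧ (⟦ r ⟧ (⟦ d ⟧ c)))  ≈⟨ r.⟦⟧-cong (d-e (U⊆C c∈)) ⟨
      ⟦ r ⟧ (⟦ d ⟧ (⟦ e ⟧ c))          ≈⟨ r.⟦⟧-cong (d.⟦⟧-cong b≈ec) ⟨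
      ⟦ r ⟧ (⟦ d ⟧ b)                  ≈⟨ r.⟦⟧-cong db≈x-y ⟩
      ⟦ r ⟧ (x +ᴹ (-ᴹ y))              ≈⟨ r.+ᴹ-homo x (-ᴹ y) ⟩
      ⟦ r ⟧ x +ᴹ ⟦ r ⟧ (-ᴹ y)          ≈⟨ +ᴹ-congˡ (r.-ᴹ-homo y) ⟩
      ⟦ r ⟧ x +ᴹ (-ᴹ (⟦ r ⟧ y))        ∎)

    f-injective : ∀ {x y} → f x H.≈ᴹ f y → x H̄.≈ᴹ y
    f-injective {x , (c , c∈ , x≈ec) , _} {y , (c′ , c′∈ , y≈ec′) , _} (b , b∈ , rdb≈) =
      ⟦ e ⟧ b , (b , b∈ , ≈ᴹ-refl) , (begin
      ⟦ d ⟧ (⟦ e ⟧ b)                          ≈⟨ d-e (U⊆C b∈) ⟩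
      ⟦ e ⟧ (⟦ r ⟧ (⟦ d ⟧ b))                  ≈⟨ e.⟦⟧-cong rdb≈ ⟩
      ⟦ e ⟧ (⟦ r ⟧ x +ᴹ (-ᴹ (⟦ r ⟧ y)))        ≈⟨ e.+ᴹ-homo _ _ ⟩
      ⟦ e ⟧ (⟦ r ⟧ x) +ᴹ ⟦ e ⟧ (-ᴹ (⟦ r ⟧ y))  ≈⟨ +ᴹ-congˡ (e.-ᴹ-homo _) ⟩
      ⟦ e ⟧ (⟦ r ⟧ x) +ᴹ (-ᴹ (⟦ e ⟧ (⟦ r ⟧ y)))
        ≈⟨ +ᴹ-cong (e-inverse (V⊆C c∈) x≈ec) (-ᴹ‿cong (e-inverse (V⊆C c′∈) y≈ec′)) ⟩
      x +ᴹ (-ᴹ y)                              ∎)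

-- Sums modulo 2

-- Lets a summand `c σ ∧ _` be rewritten under the assumption that `σ` belongs to the chain `c`.
guard : ∀ a {b c} → (a ≡ true → b ≡ c) → a ∧ b ≡ a ∧ c
guard true  e = e refl
guard false e = refl

guard-false : ∀ a {b} → (a ≡ true → b ≡ false) → a ∧ b ≡ false
guard-false true  e = e refl
guard-false false e = refl

true≢false : ∀ {b} → b ≡ true → b ≢ false
true≢false refl ()

xor≡false⇒≡ : ∀ a {b} → a xor b ≡ false → a ≡ b
xor≡false⇒≡ true  {true}  _ = refl
xor≡false⇒≡ false {false} _ = refl

xor≡true⇒⊎ : ∀ a {b} → a xor b ≡ true → a ≡ true ⊎ b ≡ true
xor≡true⇒⊎ true  _ = inj₁ refl
xor≡true⇒⊎ false e = inj₂ e

∨≡true⇒⊎ : ∀ a {b} → a ∨ b ≡ true → a ≡ true ⊎ b ≡ true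
∨≡true⇒⊎ true  _ = inj₁ refl
∨≡true⇒⊎ false e = inj₂ e

does-true⁻¹ : {A : Set a} (a? : Dec A) → does a? ≡ true → A
does-true⁻¹ (yes x) _ = x

∈⁅⁆⇒≡ : (σ τ : Subset n) → τ ∈ ⁅ σ ⁆ → τ ≡ σ
∈⁅⁆⇒≡ σ τ = does-true⁻¹ (τ ≟ σ)

∈∪ˡ : (F G : Family n) {σ : Subset n} → σ ∈ F → σ ∈ F ∪ G
∈∪ˡ F G {σ} e = cong (_∨ G σ) e

∈∪⁅⁆ : (F : Family n) (σ : Subset n) → σ ∈ F ∪ ⁅ σ ⁆
∈∪⁅⁆ F σ = trans (cong (F σ ∨_) (dec-true (σ ≟ σ) refl)) (Bool.∨-zeroʳ (F σ))

⨁-false : {f : Subset n → Bool} → (∀ σ → f σ ≡ false) → ⨁ f ≡ false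
⨁-false {n = n} e = trans (⨁-cong e) (⨁-∧ {n} false (λ _ → false))

-- Each bit of `τ` selects one half of the sum; the sets in the other half differ from `τ` in that
-- bit, so this half vanishes.
⨁-only : (f : Subset n → Bool) (τ : Subset n) → (∀ σ → σ ≢ τ → f σ ≡ false) → ⨁ f ≡ f τ
⨁-only f [] e = refl
⨁-only f (outside ∷ τ) e = trans
  (cong₂ _xor_ (⨁-only (λ σ → f (outside ∷ σ)) τ (λ σ σ≢τ → e _ λ { refl → σ≢τ refl }))
               (⨁-false (λ σ → e (inside ∷ σ) λ ())))
  (Bool.xor-identityʳ _)
⨁-only f (inside ∷ τ) e = cong₂ _xor_
  (⨁-false (λ σ → e (outside ∷ σ) λ ()))
  (⨁-only (λ σ → f (inside ∷ σ)) τ (λ σ σ≢τ → e _ λ { refl → σ≢τ refl }))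

⨁-∧ʳ : (f : Subset n → Bool) (k : Bool) → ⨁ f ∧ k ≡ ⨁ (λ σ → f σ ∧ k)
⨁-∧ʳ f k = trans (Bool.∧-comm (⨁ f) k)
  (trans (sym (⨁-∧ k f)) (⨁-cong (λ σ → Bool.∧-comm k (f σ))))

⨁-swap : ∀ {m n} (f : Subset m → Subset n → Bool) →
         ⨁ (λ σ → ⨁ (f σ)) ≡ ⨁ (λ τ → ⨁ (λ σ → f σ τ))
⨁-swap {zero}  f = refl
⨁-swap {suc m} f = trans
  (cong₂ _xor_ (⨁-swap (λ σ → f (outside ∷ σ))) (⨁-swap (λ σ → f (inside ∷ σ))))
  (sym (⨁-xor (λ τ → ⨁ (λ σ → f (outside ∷ σ) τ)) (λ τ → ⨁ (λ σ → f (inside ∷ σ) τ))))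

-- Interchanging the two sums reduces identities between composites to their values on single
-- simplices.
linearExtension-∘ : (f g : Subset n → Family n) (c : Family n) (τ : Subset n) →
  ⟦ linearExtension f ⟧ (⟦ linearExtension g ⟧ c) τ ≡
  ⨁ (λ ρ → c ρ ∧ ⟦ linearExtension f ⟧ (g ρ) τ)
linearExtension-∘ f g c τ = begin
  ⨁ (λ σ → ⨁ (λ ρ → c ρ ∧ g ρ σ) ∧ f σ τ)    ≡⟨ ⨁-cong (λ σ → ⨁-∧ʳ (λ ρ → c ρ ∧ g ρ σ) (f σ τ)) ⟩
  ⨁ (λ σ → ⨁ (λ ρ → (c ρ ∧ g ρ σ) ∧ f σ τ))  ≡⟨ ⨁-swap (λ σ ρ → (c ρ ∧ g ρ σ) ∧ f σ τ) ⟩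
  ⨁ (λ ρ → ⨁ (λ σ → (c ρ ∧ g ρ σ) ∧ f σ τ))  ≡⟨ ⨁-cong (λ ρ → ⨁-cong (λ σ → Bool.∧-assoc (c ρ) (g ρ σ) (f σ τ))) ⟩
  ⨁ (λ ρ → ⨁ (λ σ → c ρ ∧ (g ρ σ ∧ f σ τ)))  ≡⟨ ⨁-cong (λ ρ → ⨁-∧ (c ρ) (λ σ → g ρ σ ∧ f σ τ)) ⟩
  ⨁ (λ ρ → c ρ ∧ ⨁ (λ σ → g ρ σ ∧ f σ τ))    ∎
  where open ≡-Reasoning

-- By contraposition: at a set outside `F` every summand is false, hence so is the sum.
linearExtension-⊆ : (f : Subset n → Family n) (c F : Family n) →
  (∀ {σ τ} → σ ∈ c → τ ∈ f σ → τ ∈ F) → ∀ {τ} → τ ∈ ⟦ linearExtension f ⟧ c → τ ∈ F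
linearExtension-⊆ f c F f⊆F {τ} τ∈ with F τ Bool.≟ true
... | yes τ∈F = τ∈F
... | no  τ∉F = contradiction
  (⨁-false (λ σ → guard-false (c σ) (λ σ∈c → Bool.¬-not (τ∉F ∘ f⊆F σ∈c))))
  (true≢false τ∈)

-- Common setting of the two halves: (r, q) is (reference, coreference) when d is
-- the boundary and (coreference, reference) when d is the coboundary; in the
-- latter case low and up are the upper and lower regular simplices.

record Reduction (n : ℕ) : Set where
  field
    K crit low up : Family n
    classify  : ∀ {σ} → σ ∈ K → σ ∈ crit ⊎ σ ∈ low ⊎ σ ∈ up
    crit⊆K    : ∀ {σ} → σ ∈ crit → σ ∈ K
    low⊆K     : ∀ {σ} → σ ∈ low → σ ∈ K
    d dᵗ      : Subset n → Family n
    d⊆K       : ∀ {σ τ} → τ ∈ d σ → τ ∈ K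
    dᵗ⊆K      : ∀ {σ τ} → τ ∈ dᵗ σ → τ ∈ K
    transpose : ∀ {σ τ} → σ ∈ K → τ ∈ K → d σ τ ≡ dᵗ τ σ
    d²        : ∀ {σ} → σ ∈ K → ⟦ linearExtension d ⟧ (d σ) ≗ ∅
    -- In the order of the sequence, the matrix of `d` from `up` to `low` is triangular with ones on
    -- the diagonal; this is its injectivity.
    rigid     : ∀ c → (∀ {τ} → τ ∈ c → τ ∈ up) →
                (∀ {σ} → σ ∈ low → ⟦ linearExtension d ⟧ c σ ≡ false) → c ≗ ∅
    r q       : Subset n → Family n
    r⊆crit    : ∀ {σ τ} → σ ∈ K → τ ∈ r σ → τ ∈ crit
    r-crit    : ∀ {ν} → ν ∈ crit → r ν ≗ ⁅ ν ⁆
    r-up      : ∀ {τ} → τ ∈ up → r τ ≗ ∅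
    r-d-up    : ∀ {τ} → τ ∈ up → ⟦ linearExtension r ⟧ (d τ) ≗ ∅
    q-crit    : ∀ {ν} → ν ∈ crit → q ν ≗ ⁅ ν ⁆
    q-low     : ∀ {σ} → σ ∈ low → q σ ≗ ∅
    q-dᵗ-low  : ∀ {σ} → σ ∈ low → ⟦ linearExtension q ⟧ (dᵗ σ) ≗ ∅

  D r* e : Endomorphism (chainModule n)
  D  = linearExtension d
  r* = linearExtension r
  -- The transpose of `q`, cut down to `K` because the values of `q` elsewhere are arbitrary.
  e  = linearExtension (λ κ ν → K ν ∧ q ν κ)

  Critical : Family n → Set
  Critical c = ∀ {σ} → σ ∈ c → σ ∈ crit

  private
    module Hom (f : Endomorphism (chainModule n)) =
      ModuleMorphisms.IsModuleHomomorphism (Endomorphism.isModuleHomomorphism f)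

  r*-critical : ∀ {c} → (∀ {σ} → σ ∈ c → σ ∈ K) → Critical (⟦ r* ⟧ c)
  r*-critical {c} c⊆K = linearExtension-⊆ r c crit (r⊆crit ∘ c⊆K)

  D⊆K : ∀ c {τ} → τ ∈ ⟦ D ⟧ c → τ ∈ K
  D⊆K c = linearExtension-⊆ d c K (λ _ → d⊆K)

  D² : ∀ {c} → (∀ {σ} → σ ∈ c → σ ∈ K) → ⟦ D ⟧ (⟦ D ⟧ c) ≗ ∅
  D² {c} c⊆K ρ = trans (linearExtension-∘ d d c ρ)
    (⨁-false (λ σ → guard-false (c σ) (λ σ∈c → d² (c⊆K σ∈c) ρ)))

  -- Disjointness is read off from `r`: the coefficient of `r τ` at `τ` would be both true and
  -- false.
  up⇒∉crit : ∀ {τ} → τ ∈ up → crit τ ≡ false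
  up⇒∉crit {τ} τ∈up = Bool.¬-not λ τ∈crit → true≢false
    (trans (r-crit τ∈crit τ) (dec-true (τ ≟ τ) refl)) (r-up τ∈up τ)

  -- `r` fixes critical simplices and kills those in `up`, and `x` contains none from `low`.
  r*-restricts : ∀ {x} → (∀ {σ} → σ ∈ x → σ ∈ K) → (∀ {σ} → σ ∈ low → x σ ≡ false) →
                 ∀ τ → ⟦ r* ⟧ x τ ≡ x τ ∧ crit τ
  r*-restricts {x} x⊆K x-low τ = trans
    (⨁-only (λ ν → x ν ∧ r ν τ) τ (λ ν ν≢τ → guard-false (x ν) (off ν ν≢τ)))
    (guard (x τ) on)
    where
    off : ∀ ν → ν ≢ τ → ν ∈ x → r ν τ ≡ false
    off ν ν≢τ ν∈x with classify (x⊆K ν∈x)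
    ... | inj₁ ν∈crit       = trans (r-crit ν∈crit τ) (dec-false (τ ≟ ν) (ν≢τ ∘ sym))
    ... | inj₂ (inj₁ ν∈low) = contradiction (x-low ν∈low) (true≢false ν∈x)
    ... | inj₂ (inj₂ ν∈up)  = r-up ν∈up τ
    on : τ ∈ x → r τ τ ≡ crit τ
    on τ∈x with classify (x⊆K τ∈x)
    ... | inj₁ τ∈crit       = trans (trans (r-crit τ∈crit τ) (dec-true (τ ≟ τ) refl)) (sym τ∈crit)
    ... | inj₂ (inj₁ τ∈low) = contradiction (x-low τ∈low) (true≢false τ∈x)
    ... | inj₂ (inj₂ τ∈up)  = trans (r-up τ∈up τ) (sym (up⇒∉crit τ∈up))

  e-expand : ∀ c ν → ⟦ e ⟧ c ν ≡ K ν ∧ ⨁ (λ κ → c κ ∧ q ν κ)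
  e-expand c ν = trans (⨁-cong (λ κ → exchange (c κ) (K ν) (q ν κ)))
    (⨁-∧ (K ν) (λ κ → c κ ∧ q ν κ))
    where
    exchange : ∀ x y z → x ∧ (y ∧ z) ≡ y ∧ (x ∧ z)
    exchange true  y z = refl
    exchange false y z = sym (Bool.∧-zeroʳ y)

  e⊆K : ∀ c {ν} → ν ∈ ⟦ e ⟧ c → ν ∈ K
  e⊆K c {ν} ν∈ = Bool.∧-conicalˡ (K ν) _ (trans (sym (e-expand c ν)) ν∈)

  -- The chain `q ν` is the single simplex `ν`, so only the summand at `ν` survives.
  e-crit : ∀ c {ν} → ν ∈ crit → ⟦ e ⟧ c ν ≡ c ν
  e-crit c {ν} ν∈crit = begin
    ⟦ e ⟧ c ν                      ≡⟨ e-expand c ν ⟩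
    K ν ∧ ⨁ (λ κ → c κ ∧ q ν κ)    ≡⟨ cong (_∧ ⨁ (λ κ → c κ ∧ q ν κ)) (crit⊆K ν∈crit) ⟩
    ⨁ (λ κ → c κ ∧ q ν κ)          ≡⟨ ⨁-only _ ν (λ κ κ≢ν → guard-false (c κ) λ _ →
                                        trans (q-crit ν∈crit κ) (dec-false (κ ≟ ν) κ≢ν)) ⟩
    c ν ∧ q ν ν                    ≡⟨ cong (c ν ∧_) (trans (q-crit ν∈crit ν) (dec-true (ν ≟ ν) refl)) ⟩
    c ν ∧ true                     ≡⟨ Bool.∧-identityʳ (c ν) ⟩
    c ν                            ∎
    where open ≡-Reasoning

  e-low : ∀ c {ν} → ν ∈ low → ⟦ e ⟧ c ν ≡ false
  e-low c {ν} ν∈low = trans (e-expand c ν) (guard-false (K ν) λ _ →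
    ⨁-false (λ κ → guard-false (c κ) λ _ → q-low ν∈low κ))

  -- Since `e` and `d` are the transposes of `q` and `dᵗ`, this coefficient is the pairing of `c`
  -- with `q (dᵗ σ)`, which vanishes.
  D-e-low : ∀ c {σ} → σ ∈ low → ⟦ D ⟧ (⟦ e ⟧ c) σ ≡ false
  D-e-low c {σ} σ∈low = trans (linearExtension-∘ d (λ κ ν → K ν ∧ q ν κ) c σ)
    (⨁-false λ κ → guard-false (c κ) λ _ → trans (⨁-cong (adjoint κ)) (q-dᵗ-low σ∈low κ))
    where
    adjoint : ∀ κ ν → (K ν ∧ q ν κ) ∧ d ν σ ≡ dᵗ σ ν ∧ q ν κ
    adjoint κ ν with K ν in Kν
    ... | true  = trans (Bool.∧-comm (q ν κ) (d ν σ)) (cong (_∧ q ν κ) (transpose Kν (low⊆K σ∈low)))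
    -- Outside `K` the left side is cut off by the definition of `e`, the right side because `dᵗ σ`
    -- lies in `K`.
    ... | false = sym (guard-false (dᵗ σ ν) λ ν∈ → contradiction Kν (true≢false (dᵗ⊆K ν∈)))

  r*-e : ∀ {c} → Critical c → ⟦ r* ⟧ (⟦ e ⟧ c) ≗ c
  r*-e {c} c-crit τ = trans (r*-restricts (e⊆K c) (e-low c) τ) (restrict (crit τ) refl)
    where
    restrict : ∀ b → crit τ ≡ b → ⟦ e ⟧ c τ ∧ crit τ ≡ c τ
    restrict true  eq = trans (cong (⟦ e ⟧ c τ ∧_) eq) (trans (Bool.∧-identityʳ (⟦ e ⟧ c τ)) (e-crit c eq))
    restrict false eq = trans (cong (⟦ e ⟧ c τ ∧_) eq) (trans (Bool.∧-zeroʳ (⟦ e ⟧ c τ))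
      (sym (Bool.¬-not λ τ∈c → true≢false (c-crit τ∈c) eq)))

  -- e c and c differ by upper regular simplices, which r* ∘ D kills.
  r*-D-e : ∀ {c} → Critical c → ⟦ r* ⟧ (⟦ D ⟧ (⟦ e ⟧ c)) ≗ ⟦ r* ⟧ (⟦ D ⟧ c)
  r*-D-e {c} c-crit τ = xor≡false⇒≡ _ (begin
    ⟦ r* ⟧ (⟦ D ⟧ (⟦ e ⟧ c)) τ xor ⟦ r* ⟧ (⟦ D ⟧ c) τ  ≡⟨ Hom.+ᴹ-homo (r* ∘ᴱ D) (⟦ e ⟧ c) c τ ⟨
    ⟦ r* ⟧ (⟦ D ⟧ u) τ                                 ≡⟨ linearExtension-∘ r d u τ ⟩
    ⨁ (λ ρ → u ρ ∧ ⟦ r* ⟧ (d ρ) τ)                     ≡⟨ ⨁-false (λ ρ → guard-false (u ρ) λ ρ∈u → r-d-up (u⊆up ρ∈u) τ) ⟩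
    false                                              ∎)
    where
    open ≡-Reasoning
    u : Family n
    u σ = ⟦ e ⟧ c σ xor c σ

    u⊆K : ∀ {σ} → σ ∈ u → σ ∈ K
    u⊆K {σ} σ∈u with xor≡true⇒⊎ (⟦ e ⟧ c σ) σ∈u
    ... | inj₁ σ∈ec = e⊆K c σ∈ec
    ... | inj₂ σ∈c  = crit⊆K (c-crit σ∈c)

    u⊆up : ∀ {σ} → σ ∈ u → σ ∈ up
    u⊆up {σ} σ∈u with classify (u⊆K σ∈u)
    ... | inj₁ σ∈crit       = contradiction
      (trans (cong (_xor c σ) (e-crit c σ∈crit)) (Bool.xor-same (c σ))) (true≢false σ∈u)
    -- The critical chain `c` avoids `low`: at a common simplex `e c` would both agree with `c` and
    -- vanish.
    ... | inj₂ (inj₁ σ∈low) = contradiction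
      (cong₂ _xor_ (e-low c σ∈low) (Bool.¬-not λ σ∈c →
        true≢false (trans (e-crit c (c-crit σ∈c)) σ∈c) (e-low c σ∈low)))
      (true≢false σ∈u)
    ... | inj₂ (inj₂ σ∈up)  = σ∈up

  -- Both sides agree on critical simplices and vanish on `low`, so their difference is carried by
  -- `up`. Its differential vanishes on `low`, and `rigid` makes it zero.
  e-r* : ∀ {x} → (∀ {σ} → σ ∈ x → σ ∈ K) → (∀ {σ} → σ ∈ low → x σ ≡ false) →
         (∀ {σ} → σ ∈ low → ⟦ D ⟧ x σ ≡ false) → x ≗ ⟦ e ⟧ (⟦ r* ⟧ x)
  e-r* {x} x⊆K x-low Dx-low σ = xor≡false⇒≡ _ (rigid u u⊆up Du-low σ)
    where
    u : Family n
    u σ = x σ xor ⟦ e ⟧ (⟦ r* ⟧ x) σ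

    u⊆K : ∀ {σ} → σ ∈ u → σ ∈ K
    u⊆K {σ} σ∈u with xor≡true⇒⊎ (x σ) σ∈u
    ... | inj₁ σ∈x = x⊆K σ∈x
    ... | inj₂ σ∈e = e⊆K (⟦ r* ⟧ x) σ∈e

    same : ∀ {σ} → σ ∈ crit → ⟦ e ⟧ (⟦ r* ⟧ x) σ ≡ x σ
    same {σ} σ∈crit = trans (e-crit (⟦ r* ⟧ x) σ∈crit) (trans (r*-restricts x⊆K x-low σ)
      (trans (cong (x σ ∧_) σ∈crit) (Bool.∧-identityʳ (x σ))))

    u⊆up : ∀ {σ} → σ ∈ u → σ ∈ up
    u⊆up {σ} σ∈u with classify (u⊆K σ∈u)
    ... | inj₁ σ∈crit       = contradiction
      (trans (cong (x σ xor_) (same σ∈crit)) (Bool.xor-same (x σ))) (true≢false σ∈u)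
    ... | inj₂ (inj₁ σ∈low) = contradiction
      (cong₂ _xor_ (x-low σ∈low) (e-low (⟦ r* ⟧ x) σ∈low)) (true≢false σ∈u)
    ... | inj₂ (inj₂ σ∈up)  = σ∈up

    Du-low : ∀ {σ} → σ ∈ low → ⟦ D ⟧ u σ ≡ false
    Du-low {σ} σ∈low = trans (Hom.+ᴹ-homo D x (⟦ e ⟧ (⟦ r* ⟧ x)) σ)
      (cong₂ _xor_ (Dx-low σ∈low) (D-e-low (⟦ r* ⟧ x) σ∈low))

  -- The chain `D (e c)` meets the conditions of `e-r*`, the one on its own differential because `D`
  -- squares to zero.
  D-e : ∀ {c} → Critical c → ⟦ D ⟧ (⟦ e ⟧ c) ≗ ⟦ e ⟧ (⟦ r* ⟧ (⟦ D ⟧ c))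
  D-e {c} c-crit σ = trans
    (e-r* (D⊆K (⟦ e ⟧ c)) (D-e-low c) (λ {ρ} _ → D² (e⊆K c) ρ) σ)
    (Hom.⟦⟧-cong e (r*-D-e c-crit) σ)

  extension-≅ : (U V : Submodule (chainModule n) s) →
    (∀ {c} → Member U c → Critical c) → (∀ {c} → Member V c → Critical c) →
    homology (image e U) (image e V) D ≅ homology U V (r* ∘ᴱ D)
  extension-≅ = image-homology-≅ D r* e Critical r*-e D-e (λ {c} _ → r*-critical (D⊆K c))

-- The facet relation

-- Holds when `τ` is `σ` with one vertex deleted. Recursion on the vertices replaces inclusion and
-- cardinality, so that sums over all subsets can be evaluated by induction.
covers : Subset n → Subset n → Bool
covers []            []            = false
covers (inside  ∷ σ) (inside  ∷ τ) = covers σ τ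
covers (outside ∷ σ) (outside ∷ τ) = covers σ τ
covers (inside  ∷ σ) (outside ∷ τ) = does (τ ≟ σ)
covers (outside ∷ σ) (inside  ∷ τ) = false

covers⇒⊂ : (σ τ : Subset n) → covers σ τ ≡ true → τ ⊂ σ
covers⇒⊂ []            []            ()
covers⇒⊂ (inside  ∷ σ) (inside  ∷ τ) e = s⊂s (covers⇒⊂ σ τ e)
covers⇒⊂ (outside ∷ σ) (outside ∷ τ) e = s⊂s (covers⇒⊂ σ τ e)
covers⇒⊂ (inside  ∷ σ) (outside ∷ τ) e with refl ← does-true⁻¹ (τ ≟ σ) e = out⊂in (λ x∈ → x∈)

covers⇒∣∣ : (σ τ : Subset n) → covers σ τ ≡ true → suc ∣ τ ∣ ≡ ∣ σ ∣
covers⇒∣∣ []            []            ()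
covers⇒∣∣ (inside  ∷ σ) (inside  ∷ τ) e = cong suc (covers⇒∣∣ σ τ e)
covers⇒∣∣ (outside ∷ σ) (outside ∷ τ) e = covers⇒∣∣ σ τ e
covers⇒∣∣ (inside  ∷ σ) (outside ∷ τ) e with refl ← does-true⁻¹ (τ ≟ σ) e = refl

⊆∧∣∣≡⇒≡ : (σ τ : Subset n) → τ ⊆ σ → ∣ τ ∣ ≡ ∣ σ ∣ → τ ≡ σ
⊆∧∣∣≡⇒≡ []            []            _   _ = refl
⊆∧∣∣≡⇒≡ (inside  ∷ σ) (inside  ∷ τ) τ⊆σ e = cong (inside ∷_) (⊆∧∣∣≡⇒≡ σ τ (drop-∷-⊆ τ⊆σ) (ℕ.suc-injective e))
⊆∧∣∣≡⇒≡ (outside ∷ σ) (outside ∷ τ) τ⊆σ e = cong (outside ∷_) (⊆∧∣∣≡⇒≡ σ τ (drop-∷-⊆ τ⊆σ) e)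
⊆∧∣∣≡⇒≡ (inside  ∷ σ) (outside ∷ τ) τ⊆σ e =
  contradiction (ℕ.≤-trans (ℕ.≤-reflexive (sym e)) (p⊆q⇒∣p∣≤∣q∣ (drop-∷-⊆ τ⊆σ))) ℕ.1+n≰n
⊆∧∣∣≡⇒≡ (outside ∷ σ) (inside  ∷ τ) τ⊆σ e = contradiction (τ⊆σ here) λ ()

⊂⇒covers : (σ τ : Subset n) → τ ⊂ σ → suc ∣ τ ∣ ≡ ∣ σ ∣ → covers σ τ ≡ true
⊂⇒covers []            []            (_ , () , _) _
⊂⇒covers (inside  ∷ σ) (inside  ∷ τ) τ⊂σ e = ⊂⇒covers σ τ (drop-∷-⊂ τ⊂σ) (ℕ.suc-injective e)
⊂⇒covers (outside ∷ σ) (outside ∷ τ) τ⊂σ e = ⊂⇒covers σ τ (drop-∷-⊂ τ⊂σ) e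
⊂⇒covers (inside  ∷ σ) (outside ∷ τ) τ⊂σ e =
  dec-true (τ ≟ σ) (⊆∧∣∣≡⇒≡ σ τ (drop-∷-⊆ (proj₁ τ⊂σ)) (ℕ.suc-injective e))
⊂⇒covers (outside ∷ σ) (inside  ∷ τ) τ⊂σ e = contradiction (proj₁ τ⊂σ here) λ ()

dim-suc⇔ : (σ τ : Subset n) → (dim σ ≡ sucℤ (dim τ)) ⇔ (suc ∣ τ ∣ ≡ ∣ σ ∣)
dim-suc⇔ σ τ = mk⇔
  (λ e → ℤ.+-injective (begin
    + suc ∣ τ ∣                   ≡⟨ cong sucℤ (ℤ.suc-pred (+ ∣ τ ∣)) ⟨
    sucℤ (sucℤ (dim τ))           ≡⟨ cong sucℤ e ⟨
    sucℤ (dim σ)                  ≡⟨ ℤ.suc-pred (+ ∣ σ ∣) ⟩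
    + ∣ σ ∣                       ∎))
  (λ e → begin
    dim σ                         ≡⟨ cong (predℤ ∘ +_) e ⟨
    predℤ (sucℤ (+ ∣ τ ∣))        ≡⟨ ℤ.pred-suc (+ ∣ τ ∣) ⟩
    + ∣ τ ∣                       ≡⟨ ℤ.suc-pred (+ ∣ τ ∣) ⟨
    sucℤ (dim τ)                  ∎)
  where open ≡-Reasoning

dim-pred⇔ : (σ τ : Subset n) → (dim τ ≡ predℤ (dim σ)) ⇔ (dim σ ≡ sucℤ (dim τ))
dim-pred⇔ σ τ = mk⇔
  (λ e → trans (sym (ℤ.suc-pred (dim σ))) (cong sucℤ (sym e)))
  (λ e → trans (sym (ℤ.pred-suc (dim τ))) (cong predℤ (sym e)))

-- The test `E?` stays abstract because boundary and coboundary express the jump in dimension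
-- differently.
covers-does : (σ τ : Subset n) {E : Set} (E? : Dec E) → E ⇔ (suc ∣ τ ∣ ≡ ∣ σ ∣) →
              does (τ ⊂? σ) ∧ does E? ≡ covers σ τ
covers-does σ τ E? E⇔ = Bool.⇔→≡ {z = true} (mk⇔
  (λ e → ⊂⇒covers σ τ (does-true⁻¹ (τ ⊂? σ) (Bool.∧-conicalˡ (does (τ ⊂? σ)) _ e))
    (Equivalence.to E⇔ (does-true⁻¹ E? (Bool.∧-conicalʳ (does (τ ⊂? σ)) _ e))))
  (λ e → cong₂ _∧_ (dec-true (τ ⊂? σ) (covers⇒⊂ σ τ e))
    (dec-true E? (Equivalence.from E⇔ (covers⇒∣∣ σ τ e)))))

covers-irrefl : (σ : Subset n) → covers σ σ ≡ false
covers-irrefl []            = refl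
covers-irrefl (inside  ∷ σ) = covers-irrefl σ
covers-irrefl (outside ∷ σ) = covers-irrefl σ

covers-insert : (σ : Subset n) (x : Fin n) → x ∉ˢ σ → covers (σ [ x ]≔ inside) σ ≡ true
covers-insert (inside  ∷ σ) zero    x∉σ = contradiction here x∉σ
covers-insert (outside ∷ σ) zero    x∉σ = dec-true (σ ≟ σ) refl
covers-insert (inside  ∷ σ) (suc x) x∉σ = covers-insert σ x (x∉σ ∘ there)
covers-insert (outside ∷ σ) (suc x) x∉σ = covers-insert σ x (x∉σ ∘ there)

insert-⊆ : (σ τ : Subset n) (x : Fin n) → σ ⊆ τ → x ∈ˢ τ → σ [ x ]≔ inside ⊆ τ
insert-⊆ (_       ∷ σ) (_ ∷ τ) zero    σ⊆τ here        here        = here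
insert-⊆ (_       ∷ σ) (_ ∷ τ) zero    σ⊆τ here        (there y∈)  = σ⊆τ (there y∈)
insert-⊆ (inside  ∷ σ) (_ ∷ τ) (suc x) σ⊆τ (there x∈τ) here        = σ⊆τ here
insert-⊆ (_       ∷ σ) (_ ∷ τ) (suc x) σ⊆τ (there x∈τ) (there y∈)  =
  there (insert-⊆ σ τ x (drop-∷-⊆ σ⊆τ) x∈τ y∈)

-- In the mixed case the two intermediate sets arise by adding the first vertex
-- before or after the other one.
covers² : (σ ρ : Subset n) → ⨁ (λ τ → covers σ τ ∧ covers τ ρ) ≡ false
covers² []            []            = refl
covers² (inside  ∷ σ) (inside  ∷ ρ) = cong₂ _xor_
  (⨁-false (λ τ → Bool.∧-zeroʳ (does (τ ≟ σ)))) (covers² σ ρ)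
covers² {n = suc n} (outside ∷ σ) (outside ∷ ρ) = cong₂ _xor_
  (covers² σ ρ) (⨁-false {n = n} (λ _ → refl))
covers² {n = suc n} (outside ∷ σ) (inside  ∷ ρ) = cong₂ _xor_
  (⨁-false (λ τ → Bool.∧-zeroʳ (covers σ τ))) (⨁-false {n = n} (λ _ → refl))
covers² (inside  ∷ σ) (outside ∷ ρ) = trans (cong₂ _xor_
  (trans (⨁-only (λ τ → does (τ ≟ σ) ∧ covers τ ρ) σ (λ τ τ≢σ → cong (_∧ covers τ ρ) (dec-false (τ ≟ σ) τ≢σ)))
         (cong (_∧ covers σ ρ) (dec-true (σ ≟ σ) refl)))
  (trans (⨁-only (λ τ → covers σ τ ∧ does (ρ ≟ τ)) ρ (λ τ τ≢ρ → guard-false (covers σ τ) λ _ → dec-false (ρ ≟ τ) (τ≢ρ ∘ sym)))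
         (trans (cong (covers σ ρ ∧_) (dec-true (ρ ≟ ρ) refl)) (Bool.∧-identityʳ (covers σ ρ)))))
  (Bool.xor-same (covers σ ρ))

-- Boundary and coboundary operators of a complex

module _ (K : SimplicialComplex n) where

  open SimplicialComplex K using (nonempty; closed)

  boundary≡ : ∀ σ τ → boundary K σ τ ≡ simplices K τ ∧ covers σ τ
  boundary≡ σ τ = cong (simplices K τ ∧_) (covers-does σ τ (dim τ ℤ.≟ predℤ (dim σ))
    (dim-suc⇔ σ τ ⇔-∘ dim-pred⇔ σ τ))

  coboundary≡ : ∀ σ τ → coboundary K σ τ ≡ simplices K τ ∧ covers τ σ
  coboundary≡ σ τ = cong (simplices K τ ∧_) (covers-does τ σ (dim τ ℤ.≟ sucℤ (dim σ)) (dim-suc⇔ τ σ))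

  boundary⊆K : ∀ {σ τ} → τ ∈ boundary K σ → τ ∈ simplices K
  boundary⊆K {σ} {τ} = Bool.∧-conicalˡ (simplices K τ) _

  coboundary⊆K : ∀ {σ τ} → τ ∈ coboundary K σ → τ ∈ simplices K
  coboundary⊆K {σ} {τ} = Bool.∧-conicalˡ (simplices K τ) _

  boundary-covers : ∀ {σ τ} → τ ∈ simplices K → boundary K σ τ ≡ covers σ τ
  boundary-covers {σ} {τ} τ∈K = trans (boundary≡ σ τ) (cong (_∧ covers σ τ) τ∈K)

  coboundary-covers : ∀ {σ τ} → τ ∈ simplices K → coboundary K σ τ ≡ covers τ σ
  coboundary-covers {σ} {τ} τ∈K = trans (coboundary≡ σ τ) (cong (_∧ covers τ σ) τ∈K)

  boundary-transpose : ∀ {σ τ} → σ ∈ simplices K → τ ∈ simplices K → boundary K σ τ ≡ coboundary K τ σ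
  boundary-transpose σ∈K τ∈K = trans (boundary-covers τ∈K) (sym (coboundary-covers σ∈K))

  -- `τ` is a face of `σ`, and a vertex of `ρ` supplies the nonemptiness that `closed` demands.
  between : ∀ {σ τ ρ} → σ ∈ simplices K → ρ ∈ simplices K →
            covers σ τ ≡ true → covers τ ρ ≡ true → τ ∈ simplices K
  between {σ} {τ} {ρ} σ∈K ρ∈K σ>τ τ>ρ with x , x∈ρ ← nonempty ρ∈K =
    closed σ∈K (proj₁ (covers⇒⊂ σ τ σ>τ)) (x , proj₁ (covers⇒⊂ τ ρ τ>ρ) x∈ρ)

  -- For `ρ` in `K`, `between` shows that restricting to simplices loses no term, so the sum is that
  -- of `covers²`; otherwise every term is false.
  boundary² : ∀ {σ} → σ ∈ simplices K → ⟦ ∂ K ⟧ (boundary K σ) ≗ ∅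
  boundary² {σ} σ∈K ρ with simplices K ρ Bool.≟ true
  ... | no  ρ∉K = ⨁-false (λ τ → guard-false (boundary K σ τ) λ _ → Bool.¬-not (ρ∉K ∘ boundary⊆K {τ}))
  ... | yes ρ∈K = trans (⨁-cong term) (covers² σ ρ)
    where
    term : ∀ τ → boundary K σ τ ∧ boundary K τ ρ ≡ covers σ τ ∧ covers τ ρ
    term τ = Bool.⇔→≡ {z = true} (mk⇔
      (λ e → let σ>τ = Bool.∧-conicalˡ (boundary K σ τ) _ e in cong₂ _∧_
        (trans (sym (boundary-covers (boundary⊆K {σ} σ>τ))) σ>τ)
        (trans (sym (boundary-covers {τ} ρ∈K)) (Bool.∧-conicalʳ (boundary K σ τ) _ e)))
      (λ e → let σ>τ = Bool.∧-conicalˡ _ _ e; τ>ρ = Bool.∧-conicalʳ (covers σ τ) _ e in cong₂ _∧_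
        (trans (boundary-covers (between σ∈K ρ∈K σ>τ τ>ρ)) σ>τ)
        (trans (boundary-covers ρ∈K) τ>ρ)))

  coboundary² : ∀ {σ} → σ ∈ simplices K → ⟦ δ K ⟧ (coboundary K σ) ≗ ∅
  coboundary² {σ} σ∈K ρ with simplices K ρ Bool.≟ true
  ... | no  ρ∉K = ⨁-false (λ τ → guard-false (coboundary K σ τ) λ _ → Bool.¬-not (ρ∉K ∘ coboundary⊆K {τ}))
  ... | yes ρ∈K = trans (⨁-cong term) (covers² ρ σ)
    where
    term : ∀ τ → coboundary K σ τ ∧ coboundary K τ ρ ≡ covers ρ τ ∧ covers τ σ
    term τ = Bool.⇔→≡ {z = true} (mk⇔
      (λ e → let τ>σ = Bool.∧-conicalˡ (coboundary K σ τ) _ e in cong₂ _∧_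
        (trans (sym (coboundary-covers {τ} ρ∈K)) (Bool.∧-conicalʳ (coboundary K σ τ) _ e))
        (trans (sym (coboundary-covers (coboundary⊆K {σ} τ>σ))) τ>σ))
      (λ e → let ρ>τ = Bool.∧-conicalˡ _ _ e; τ>σ = Bool.∧-conicalʳ (covers ρ τ) _ e in cong₂ _∧_
        (trans (coboundary-covers (between ρ∈K σ∈K ρ>τ τ>σ)) τ>σ)
        (trans (coboundary-covers ρ∈K) ρ>τ)))

-- Simplices of a Morse sequence

Expansion-⊆ : ∀ {L K : SimplicialComplex n} {σ τ} → Expansion L K σ τ →
              ∀ {ρ} → ρ ∈ simplices L → ρ ∈ simplices K
Expansion-⊆ E {ρ} ρ∈L = proj₁ (Equivalence.to (Expansion.difference E ρ) ρ∈L)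

Filling-⊆ : ∀ {L K : SimplicialComplex n} {ν} → Filling L K ν →
            ∀ {ρ} → ρ ∈ simplices L → ρ ∈ simplices K
Filling-⊆ F {ρ} ρ∈L = proj₁ (Equivalence.to (Filling.difference F ρ) ρ∈L)

critical⊆K : {K : SimplicialComplex n} (W : MorseSequence K) → ∀ {ρ} → ρ ∈ critical W → ρ ∈ simplices K
critical⊆K (expand W σ τ E) ρ∈ = Expansion-⊆ E (critical⊆K W ρ∈)
critical⊆K (fill W ν F) {ρ} ρ∈ with ∨≡true⇒⊎ (critical W ρ) ρ∈
... | inj₁ ρ∈W = Filling-⊆ F (critical⊆K W ρ∈W)
... | inj₂ ρ∈ν with refl ← ∈⁅⁆⇒≡ ν ρ ρ∈ν = Facet.ν∈K (Filling.facet F)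

lowerRegular⊆K : {K : SimplicialComplex n} (W : MorseSequence K) → ∀ {ρ} → ρ ∈ lowerRegular W → ρ ∈ simplices K
lowerRegular⊆K (fill W ν F) ρ∈ = Filling-⊆ F (lowerRegular⊆K W ρ∈)
lowerRegular⊆K (expand W σ τ E) {ρ} ρ∈ with ∨≡true⇒⊎ (lowerRegular W ρ) ρ∈
... | inj₁ ρ∈W = Expansion-⊆ E (lowerRegular⊆K W ρ∈W)
... | inj₂ ρ∈σ with refl ← ∈⁅⁆⇒≡ σ ρ ρ∈σ = FreePair.σ∈K (Expansion.freePair E)

upperRegular⊆K : {K : SimplicialComplex n} (W : MorseSequence K) → ∀ {ρ} → ρ ∈ upperRegular W → ρ ∈ simplices K
upperRegular⊆K (fill W ν F) ρ∈ = Filling-⊆ F (upperRegular⊆K W ρ∈)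
upperRegular⊆K (expand W σ τ E) {ρ} ρ∈ with ∨≡true⇒⊎ (upperRegular W ρ) ρ∈
... | inj₁ ρ∈W = Expansion-⊆ E (upperRegular⊆K W ρ∈W)
... | inj₂ ρ∈τ with refl ← ∈⁅⁆⇒≡ τ ρ ρ∈τ = FreePair.τ∈K (Expansion.freePair E)

classification : {K : SimplicialComplex n} (W : MorseSequence K) → ∀ {ρ} → ρ ∈ simplices K →
                 ρ ∈ critical W ⊎ ρ ∈ lowerRegular W ⊎ ρ ∈ upperRegular W
classification (start K≗∅) {ρ} ρ∈K = contradiction (K≗∅ ρ) (true≢false ρ∈K)
classification (expand W σ τ E) {ρ} ρ∈K = split (ρ ≟ σ) (ρ ≟ τ)
  where
  split : Dec (ρ ≡ σ) → Dec (ρ ≡ τ) →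
          ρ ∈ critical W ⊎ ρ ∈ lowerRegular W ∪ ⁅ σ ⁆ ⊎ ρ ∈ upperRegular W ∪ ⁅ τ ⁆
  split (yes refl) _          = inj₂ (inj₁ (∈∪⁅⁆ (lowerRegular W) σ))
  split (no _)     (yes refl) = inj₂ (inj₂ (∈∪⁅⁆ (upperRegular W) τ))
  split (no ρ≢σ)   (no ρ≢τ)   = map₂ (map (∈∪ˡ (lowerRegular W) ⁅ σ ⁆) (∈∪ˡ (upperRegular W) ⁅ τ ⁆))
    (classification W (Equivalence.from (Expansion.difference E ρ) (ρ∈K , ρ≢σ , ρ≢τ)))
classification (fill W ν F) {ρ} ρ∈K = split (ρ ≟ ν)
  where
  split : Dec (ρ ≡ ν) → ρ ∈ critical W ∪ ⁅ ν ⁆ ⊎ ρ ∈ lowerRegular W ⊎ ρ ∈ upperRegular W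
  split (yes refl) = inj₁ (∈∪⁅⁆ (critical W) ν)
  split (no ρ≢ν)   = map₁ (∈∪ˡ (critical W) ⁅ ν ⁆)
    (classification W (Equivalence.from (Filling.difference F ρ) (ρ∈K , ρ≢ν)))

-- Free pairs and the rigidity of regular chains

free-coface : ∀ {K : SimplicialComplex n} {σ τ} → FreePair K σ τ →
              ∀ {ρ} → ρ ∈ simplices K → covers ρ σ ≡ true → ρ ≡ τ
free-coface {σ = σ} P {ρ} ρ∈K ρ>σ = FreePair.only P ρ∈K (proj₁ (covers⇒⊂ ρ σ ρ>σ))
  λ { refl → true≢false ρ>σ (covers-irrefl ρ) }

-- Adding to σ one vertex of τ gives a coface of σ, which can only be τ.
free-covers : ∀ {K : SimplicialComplex n} {σ τ} → FreePair K σ τ → covers τ σ ≡ true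
free-covers {K = K} {σ} {τ} P with σ⊆τ , x , x∈τ , x∉σ ← FreePair.σ⊂τ P =
  subst (λ ρ → covers ρ σ ≡ true) (free-coface P ρ∈K ρ>σ) ρ>σ
  where
  ρ>σ = covers-insert σ x x∉σ
  ρ∈K = SimplicialComplex.closed K (FreePair.τ∈K P) (insert-⊆ σ τ x σ⊆τ x∈τ)
    (x , []≔-updates σ x)

-- Induction from the end of the sequence: in the last pair `τ` is the only simplex covering `σ`, so
-- the condition at `σ` reads `c τ ≡ false`, and `c` then lives on the earlier pairs. Using `covers`
-- instead of `boundary K` keeps the condition independent of the complex, which shrinks in the
-- induction.
upper-rigid : {K : SimplicialComplex n} (W : MorseSequence K) (c : Family n) →
  (∀ {τ} → τ ∈ c → τ ∈ upperRegular W) →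
  (∀ {σ} → σ ∈ lowerRegular W → ⨁ (λ τ → c τ ∧ covers τ σ) ≡ false) → c ≗ ∅
upper-rigid (start _) c c⊆up _ ρ = Bool.¬-not λ ρ∈c → contradiction (c⊆up ρ∈c) λ ()
upper-rigid (fill W ν F) = upper-rigid W
upper-rigid W′@(expand W σ τ E) c c⊆up dc-low = upper-rigid W c c⊆upW
  (λ ρ∈low → dc-low (∈∪ˡ (lowerRegular W) ⁅ σ ⁆ ρ∈low))
  where
  P = Expansion.freePair E

  cτ≡false : c τ ≡ false
  cτ≡false = begin
    c τ                              ≡⟨ Bool.∧-identityʳ (c τ) ⟨
    c τ ∧ true                       ≡⟨ cong (c τ ∧_) (free-covers P) ⟨
    c τ ∧ covers τ σ                 ≡⟨ ⨁-only _ τ (λ ρ ρ≢τ → guard-false (c ρ) λ ρ∈c → Bool.¬-not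
                                          (ρ≢τ ∘ free-coface P (upperRegular⊆K W′ (c⊆up ρ∈c)))) ⟨
    ⨁ (λ ρ → c ρ ∧ covers ρ σ)       ≡⟨ dc-low (∈∪⁅⁆ (lowerRegular W) σ) ⟩
    false                            ∎
    where open ≡-Reasoning

  c⊆upW : ∀ {ρ} → ρ ∈ c → ρ ∈ upperRegular W
  c⊆upW {ρ} ρ∈c with ∨≡true⇒⊎ (upperRegular W ρ) (c⊆up ρ∈c)
  ... | inj₁ ρ∈up = ρ∈up
  ... | inj₂ ρ∈τ with refl ← ∈⁅⁆⇒≡ τ ρ ρ∈τ = contradiction cτ≡false (true≢false ρ∈c)

-- No older upper regular simplex covers the last `σ`, so deleting `σ` from `c` preserves the older
-- conditions and the remainder vanishes by induction. The condition at `τ` then reads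
-- `c σ ≡ false`.
lower-rigid : {K : SimplicialComplex n} (W : MorseSequence K) (c : Family n) →
  (∀ {σ} → σ ∈ c → σ ∈ lowerRegular W) →
  (∀ {τ} → τ ∈ upperRegular W → ⨁ (λ σ → c σ ∧ covers τ σ) ≡ false) → c ≗ ∅
lower-rigid (start _) c c⊆low _ ρ = Bool.¬-not λ ρ∈c → contradiction (c⊆low ρ∈c) λ ()
lower-rigid (fill W ν F) = lower-rigid W
lower-rigid (expand W σ τ E) c c⊆low dc-up = c≗∅
  where
  P = Expansion.freePair E

  -- `σ` is set aside, as its coefficient can be isolated only once all others are known to be zero.
  c₀ : Family _
  c₀ ρ = c ρ ∧ not (⁅ σ ⁆ ρ)

  c₀⊆low : ∀ {ρ} → ρ ∈ c₀ → ρ ∈ lowerRegular W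
  c₀⊆low {ρ} ρ∈ with ∨≡true⇒⊎ (lowerRegular W ρ) (c⊆low (Bool.∧-conicalˡ (c ρ) _ ρ∈))
  ... | inj₁ ρ∈low = ρ∈low
  ... | inj₂ ρ∈σ   = contradiction (cong not ρ∈σ) (true≢false (Bool.∧-conicalʳ (c ρ) _ ρ∈))

  -- Such a `ρ` lies in the complex before the expansion, which omits `τ`, the only proper coface of
  -- `σ` after it.
  old-coface : ∀ {ρ} → ρ ∈ upperRegular W → covers ρ σ ≡ false
  old-coface {ρ} ρ∈up = Bool.¬-not λ ρ>σ →
    let ρ∈K , _ , ρ≢τ = Equivalence.to (Expansion.difference E ρ) (upperRegular⊆K W ρ∈up)
    in ρ≢τ (free-coface P ρ∈K ρ>σ)

  c₀-covers : ∀ {ρ} → ρ ∈ upperRegular W → ∀ π → c₀ π ∧ covers ρ π ≡ c π ∧ covers ρ π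
  c₀-covers {ρ} ρ∈up π with π ≟ σ
  ... | yes refl = trans (guard-false (c π ∧ false) (λ _ → old-coface ρ∈up))
                         (sym (guard-false (c π) (λ _ → old-coface ρ∈up)))
  ... | no _     = cong (_∧ covers ρ π) (Bool.∧-identityʳ (c π))

  c₀≗∅ : c₀ ≗ ∅
  c₀≗∅ = lower-rigid W c₀ c₀⊆low λ ρ∈up →
    trans (⨁-cong (c₀-covers ρ∈up)) (dc-up (∈∪ˡ (upperRegular W) ⁅ τ ⁆ ρ∈up))

  c-off : ∀ ρ → ρ ≢ σ → c ρ ≡ false
  c-off ρ ρ≢σ = trans (sym (trans (cong (λ b → c ρ ∧ not b) (dec-false (ρ ≟ σ) ρ≢σ)) (Bool.∧-identityʳ (c ρ)))) (c₀≗∅ ρ)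

  cσ≡false : c σ ≡ false
  cσ≡false = begin
    c σ                              ≡⟨ Bool.∧-identityʳ (c σ) ⟨
    c σ ∧ true                       ≡⟨ cong (c σ ∧_) (free-covers P) ⟨
    c σ ∧ covers τ σ                 ≡⟨ ⨁-only _ σ (λ ρ ρ≢σ → cong (_∧ covers τ ρ) (c-off ρ ρ≢σ)) ⟨
    ⨁ (λ ρ → c ρ ∧ covers τ ρ)       ≡⟨ dc-up (∈∪⁅⁆ (upperRegular W) τ) ⟩
    false                            ∎
    where open ≡-Reasoning

  c≗∅ : c ≗ ∅
  c≗∅ ρ with ρ ≟ σ
  ... | yes refl = cσ≡false
  ... | no ρ≢σ   = c-off ρ ρ≢σ

-- The boundary and coboundary instances

module _ {K : SimplicialComplex n} {W : MorseSequence K} (ref : ReferenceMap W) (coref : CoreferenceMap W) where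

  private
    module R = ReferenceMap ref
    module Q = CoreferenceMap coref

  boundaryReduction : Reduction n
  boundaryReduction = record
    { K = simplices K ; crit = critical W ; low = lowerRegular W ; up = upperRegular W
    ; classify  = classification W
    ; crit⊆K    = critical⊆K W
    ; low⊆K     = lowerRegular⊆K W
    ; d         = boundary K
    ; dᵗ        = coboundary K
    ; d⊆K       = λ {σ} → boundary⊆K K {σ}
    ; dᵗ⊆K      = λ {σ} → coboundary⊆K K {σ}
    ; transpose = boundary-transpose K
    ; d²        = boundary² K
    ; rigid     = λ c c⊆up dc-low → upper-rigid W c c⊆up λ σ∈low → trans
        (⨁-cong (λ τ → cong (c τ ∧_) (sym (boundary-covers K (lowerRegular⊆K W σ∈low))))) (dc-low σ∈low)
    ; r         = R.map
    ; q         = Q.map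
    -- `map-chain` is taken in degree `dim σ`, whence `refl`.
    ; r⊆crit    = λ σ∈K τ∈ → proj₂ (R.map-chain (σ∈K , refl) τ∈)
    ; r-crit    = R.on-critical
    ; r-up      = R.on-upper
    ; r-d-up    = R.on-boundary
    ; q-crit    = Q.on-critical
    ; q-low     = Q.on-lower
    ; q-dᵗ-low  = Q.on-coboundary
    }

  coboundaryReduction : Reduction n
  coboundaryReduction = record
    { K = simplices K ; crit = critical W ; low = upperRegular W ; up = lowerRegular W
    ; classify  = λ σ∈K → map₂ swap (classification W σ∈K)
    ; crit⊆K    = critical⊆K W
    ; low⊆K     = upperRegular⊆K W
    ; d         = coboundary K
    ; dᵗ        = boundary K
    ; d⊆K       = λ {σ} → coboundary⊆K K {σ}
    ; dᵗ⊆K      = λ {σ} → boundary⊆K K {σ}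
    ; transpose = λ σ∈K τ∈K → sym (boundary-transpose K τ∈K σ∈K)
    ; d²        = coboundary² K
    ; rigid     = λ c c⊆low dc-up → lower-rigid W c c⊆low λ τ∈up → trans
        (⨁-cong (λ σ → cong (c σ ∧_) (sym (coboundary-covers K (upperRegular⊆K W τ∈up))))) (dc-up τ∈up)
    ; r         = Q.map
    ; q         = R.map
    ; r⊆crit    = λ σ∈K τ∈ → proj₂ (Q.map-chain (σ∈K , refl) τ∈)
    ; r-crit    = Q.on-critical
    ; r-up      = Q.on-lower
    ; r-d-up    = Q.on-coboundary
    ; q-crit    = R.on-critical
    ; q-low     = R.on-upper
    ; q-dᵗ-low  = R.on-boundary
    }

theorem11 : ∀ {n : ℕ} (K : SimplicialComplex n) (W : MorseSequence K)
    (ref : ReferenceMap W) (coref : CoreferenceMap W) (p : ℤ) →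
    (extensionHomology coref p ≅ criticalHomology ref p)
    × (coextensionCohomology ref p ≅ cocriticalCohomology coref p)
theorem11 K W ref coref p =
    -- Incoming chains have degree `p + 1` for the boundary and `p - 1` for the coboundary; degrees
    -- enter only through these subspaces, whose members are critical chains.
    Reduction.extension-≅ (boundaryReduction ref coref) (Ŵ[ W ] (sucℤ p)) (Ŵ[ W ] p)
      (λ c∈ σ∈c → proj₂ (c∈ σ∈c)) (λ c∈ σ∈c → proj₂ (c∈ σ∈c))
  , Reduction.extension-≅ (coboundaryReduction ref coref) (Ŵ[ W ] (predℤ p)) (Ŵ[ W ] p)
      (λ c∈ σ∈c → proj₂ (c∈ σ∈c)) (λ c∈ σ∈c → proj₂ (c∈ σ∈c))
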